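{- Let $\mathcal{P}$ be the set of all primes. Every subset of $\mathcal{P}$ of positive upper density (relative to $\mathcal{P}$) linearly admits a 4-cycle.
   Context: The upper density of $A\subseteq\mathcal{P}$ relative to the primes is $\limsup_{N\to\infty}|A\cap[1,N]|/|\mathcal{P}\cap[1,N]|$. A (possibly infinite) set of primes $A$ linearly admits a 4-cycle if there exist signs $\epsilon_1,\epsilon_2,\epsilon_3,\epsilon_4\in\{ -1,1\}$ and positive integers $u_1,u_2,u_3,u_4$, each of which is a product of finitely many pairwise distinct primes from $A$ (the empty product $1$ being allowed), such that $\epsilon_1u_1+\epsilon_2u_2+\epsilon_3u_3+\epsilon_4u_4=0$ and no proper nonempty subsum vanishes (i.e. $\sum_{i\in I}\epsilon_iu_i\neq 0$ for every $\emptyset\ne I\subsetneq\{1,2,3,4\}$). The $u_i$ need not be distinct. -}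

module Defs where

open import Data.Bool.Base using (if_then_else_)
open import Data.Fin.Base using (Fin)
open import Data.Fin.Subset using (Subset; Nonempty; ⊤; _⊂_)
open import Data.Integer.Base as ℤ using (ℤ; +_; 0ℤ; _◃_)
open import Data.Integer.Properties using (+-0-monoid)
open import Data.List.Base using (length; filter; applyUpTo)
open import Data.List.Relation.Unary.All using (All)
open import Data.List.Relation.Unary.Unique.Propositional using (Unique)
open import Data.Nat.Base using (ℕ; suc; NonZero; _≤_; _<_)
open import Data.Nat.ListAction using (product)
open import Data.Nat.Primality using (prime?)
open import Data.Product.Base using (Σ; ∃-syntax; _×_)
open import Data.Rational.Base as ℚ using (ℚ; 0ℚ)
open import Data.Sign.Base using (Sign)
open import Data.Vec.Base using (lookup)
open import Function.Definitions using (Injective)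
open import Level using (Level)
open import Relation.Binary.PropositionalEquality.Core using (_≡_; _≢_)
open import Relation.Unary using (Pred; _∩_)
import Algebra.Properties.Monoid.Sum as MonoidSum

open MonoidSum +-0-monoid using (sum)

private
  variable
    ℓ : Level

-- An element of [-∞,+∞] is represented by its lower cut, the set of rationals
-- strictly below it.  This allows lim sup to be defined without any assumption
-- that it can be computed, and sets of numbers need not be decidable.

LowerReal : (ℓ : Level) → Set _
LowerReal ℓ = Pred ℚ ℓ

sup≥ : ℕ → (ℕ → LowerReal ℓ) → LowerReal ℓ
sup≥ M x q = ∃[ n ] M ≤ n × x n q

-- q < inf s iff some r > q is strictly below every term; the gap is needed
-- because an infimum may be smaller than all the terms.

inf : (ℕ → LowerReal ℓ) → LowerReal ℓ
inf s q = ∃[ r ] q ℚ.< r × (∀ M → s M r)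

limsup : (ℕ → LowerReal ℓ) → LowerReal ℓ
limsup x = inf (λ M → sup≥ M x)

[1,_] : ℕ → Pred ℕ _
[1, N ] n = 1 ≤ n × n ≤ N

-- k is at most the cardinality of S.  The injection goes into ℕ rather than
-- ∃ S so that different proofs of membership are not counted separately.

_≤∣_∣ : ℕ → Pred ℕ ℓ → Set ℓ
k ≤∣ S ∣ = Σ (Fin k → ℕ) λ f → Injective _≡_ _≡_ f × (∀ i → S (f i))

π : ℕ → ℕ
π N = length (filter prime? (applyUpTo suc N))

-- The lower cut of |A ∩ [1,N]| / π(N).  For N < 2 the quotient is undefined and
-- the cut is empty, which has no effect on the limit superior.

relativeCount : Pred ℕ ℓ → ℕ → LowerReal ℓ
relativeCount A N q =
  ∃[ k ] k ≤∣ A ∩ [1, N ] ∣ × Σ (NonZero (π N)) λ nz → q ℚ.< ℚ._/_ (+ k) (π N) {{nz}}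

upperDensity : Pred ℕ ℓ → LowerReal ℓ
upperDensity A = limsup (relativeCount A)

PositiveUpperDensity : Pred ℕ ℓ → Set ℓ
PositiveUpperDensity A = upperDensity A 0ℚ

ProductOfDistinct : Pred ℕ ℓ → ℕ → Set ℓ
ProductOfDistinct A u = ∃[ ps ] Unique ps × All A ps × product ps ≡ u

subsum : ∀ {n} → Subset n → (Fin n → ℤ) → ℤ
subsum I t = sum (λ i → if lookup I i then t i else 0ℤ)

-- The term ε i ◃ u i is the integer of sign ε i and absolute value u i.

LinearlyAdmits4Cycle : Pred ℕ ℓ → Set ℓ
LinearlyAdmits4Cycle A =
  Σ (Fin 4 → Sign) λ ε →
  Σ (Fin 4 → ℕ) λ u →
    (∀ i → 0 < u i × ProductOfDistinct A (u i)) ×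
    sum (λ i → ε i ◃ u i) ≡ 0ℤ ×
    (∀ (I : Subset 4) → Nonempty I → I ⊂ ⊤ → subsum I (λ i → ε i ◃ u i) ≢ 0ℤ)

{-# OPTIONS --safe #-}

-- A set of k > 1 positive integers up to N with k (k ∸ 1) > 2 N has a repeated
-- difference a - b = c - d with a ≠ b and a ≠ c, and then a + d - b - c = 0 is
-- a 4-cycle whose terms are single primes.  To see that a set of positive upper
-- density has so many elements below some N, a weak form of Chebyshev's bound
-- suffices: 2 ^ (N - 1) ≤ lcm(1, …, N) ≤ N ^ π(N).  The left inequality holds
-- because N C(N-1,m) divides lcm(1, …, N) (Leibniz's harmonic triangle), the
-- right one because a prime power dividing lcm(1, …, N) is at most N.

module Submission where

open import Defs
open import Data.Bool.Base using (Bool; true; false; if_then_else_)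
open import Data.Fin.Base using (Fin; zero; suc; punchIn; remQuot; fromℕ<; combine)
import Data.Fin.Properties as Fin
open import Data.Fin.Subset using (Nonempty; ⊤; _⊂_)
open import Data.Fin.Subset.Properties using (∉⊥)
open import Data.Integer.Base as ℤ using (0ℤ; _◃_)
import Data.Integer.Properties as ℤ
open import Data.List.Base using ([]; _∷_; length; filter; applyUpTo)
open import Data.List.Membership.Propositional using (_∈_)
open import Data.List.Membership.Propositional.Properties using (∈-filter⁺; ∈-applyUpTo⁺)
open import Data.List.Relation.Unary.All using (All; []; _∷_)
open import Data.List.Relation.Unary.All.Properties using (all-filter)
open import Data.List.Relation.Unary.AllPairs using ([]; _∷_)
open import Data.List.Relation.Unary.Any using (here; there)
open import Data.Nat.Base
open import Data.Nat.Combinatorics using (_C_; nCk+nC[k+1]≡[n+1]C[k+1]; k>n⇒nCk≡0)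
open import Data.Nat.Divisibility
open import Data.Nat.ListAction using (product)
open import Data.Nat.Primality using (Prime; prime?; prime⇒nonZero; prime⇒nonTrivial)
open import Data.Nat.Primality.Factorisation using (PrimeFactorisation; factorise)
open import Data.Nat.Properties
open import Data.Nat.Tactic.RingSolver using (solve-∀)
open import Data.Product.Base using (∃-syntax; _×_; _,_; proj₁; proj₂; uncurry)
open import Data.Rational.Base as ℚ using (0ℚ)
import Data.Rational.Properties as ℚ
import Data.Rational.Unnormalised.Base as ℚᵘ
import Data.Rational.Unnormalised.Properties as ℚᵘ
open import Data.Sign.Base as Sign using (Sign)
open import Data.Sum.Base using (_⊎_; inj₁; inj₂)
open import Data.Vec.Base as Vec using ([]; _∷_)
open import Level using (Level)
open import Relation.Binary.PropositionalEquality
open import Relation.Nullary.Decidable using (yes; no)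
open import Relation.Nullary.Negation using (¬_; contradiction)
open import Relation.Unary using (Pred; _⊆_; _∩_)

-- Binomial coefficients

k≤n⇒nCk>0 : ∀ {n k} → k ≤ n → n C k > 0
k≤n⇒nCk>0 z≤n = s≤s z≤n
k≤n⇒nCk>0 {suc n} {suc k} (s≤s k≤n) = begin-strict
  0                  <⟨ k≤n⇒nCk>0 k≤n ⟩
  n C k              ≤⟨ m≤m+n _ _ ⟩
  n C k + n C suc k  ≡⟨ nCk+nC[k+1]≡[n+1]C[k+1] n k ⟩
  suc n C suc k      ∎
  where open ≤-Reasoning

-- Induction on `n`: Pascal's rule on the left leaves `x` plus two products, and the hypothesis
-- applies to each of these.
absorption : ∀ n k → suc k * (suc n C suc k) ≡ suc n * (n C k)
absorption zero    zero    = refl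
absorption zero    (suc k) = begin
  suc (suc k) * (1 C suc (suc k))  ≡⟨ cong (suc (suc k) *_) (k>n⇒nCk≡0 {1} {suc (suc k)} (s≤s (s≤s z≤n))) ⟩
  suc (suc k) * 0                  ≡⟨ *-zeroʳ (suc (suc k)) ⟩
  0                                ≡⟨ cong (1 *_) (k>n⇒nCk≡0 {0} {suc k} (s≤s z≤n)) ⟨
  1 * (0 C suc k)                  ∎
  where open ≡-Reasoning
absorption (suc n) zero    = begin
  1 * (suc (suc n) C 1)               ≡⟨ cong (1 *_) (nCk+nC[k+1]≡[n+1]C[k+1] (suc n) 0) ⟨
  1 * (1 + suc n C 1)                 ≡⟨ *-distribˡ-+ 1 1 _ ⟩
  1 + 1 * (suc n C 1)                 ≡⟨ cong suc (absorption n 0) ⟩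
  suc (suc n) * 1                     ∎
  where open ≡-Reasoning
absorption (suc n) (suc k) = begin
  suc (suc k) * (suc (suc n) C suc (suc k))            ≡⟨ cong (suc (suc k) *_) (nCk+nC[k+1]≡[n+1]C[k+1] (suc n) (suc k)) ⟨
  suc (suc k) * (x + suc n C suc (suc k))              ≡⟨ *-distribˡ-+ (suc (suc k)) x _ ⟩
  x + suc k * x + suc (suc k) * (suc n C suc (suc k))  ≡⟨ cong₂ (λ y z → x + y + z) (absorption n k) (absorption n (suc k)) ⟩
  x + suc n * (n C k) + suc n * (n C suc k)            ≡⟨ +-assoc x _ _ ⟩
  x + (suc n * (n C k) + suc n * (n C suc k))          ≡⟨ cong (x +_) (*-distribˡ-+ (suc n) (n C k) (n C suc k)) ⟨
  x + suc n * (n C k + n C suc k)                      ≡⟨ cong (λ y → x + suc n * y) (nCk+nC[k+1]≡[n+1]C[k+1] n k) ⟩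
  suc (suc n) * x                                      ∎
  where open ≡-Reasoning
        x = suc n C suc k

ΣC : ℕ → ℕ → ℕ
ΣC n zero    = 0
ΣC n (suc k) = ΣC n k + n C k

-- Pascal's rule summed over the columns; column 0 has no left neighbour, so one of the sums is a
-- term shorter.
ΣC-pascal : ∀ n k → ΣC (suc n) (suc k) ≡ ΣC n k + ΣC n (suc k)
ΣC-pascal n zero    = refl
ΣC-pascal n (suc k) = begin
  ΣC (suc n) (suc k) + suc n C suc k              ≡⟨ cong₂ _+_ (ΣC-pascal n k) (sym (nCk+nC[k+1]≡[n+1]C[k+1] n k)) ⟩
  ΣC n k + ΣC n (suc k) + (n C k + n C suc k)     ≡⟨ lemma (ΣC n k) (ΣC n (suc k)) (n C k) (n C suc k) ⟩
  ΣC n k + n C k + (ΣC n (suc k) + n C suc k)     ∎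
  where
  open ≡-Reasoning
  lemma : ∀ a b c d → a + b + (c + d) ≡ a + c + (b + d)
  lemma = solve-∀

ΣC-row : ∀ n → ΣC n (suc n) ≡ 2 ^ n
ΣC-row zero    = refl
ΣC-row (suc n) = begin
  ΣC (suc n) (suc (suc n))                       ≡⟨ ΣC-pascal n (suc n) ⟩
  ΣC n (suc n) + (ΣC n (suc n) + n C suc n)      ≡⟨ cong (λ x → ΣC n (suc n) + (ΣC n (suc n) + x)) (k>n⇒nCk≡0 (n<1+n n)) ⟩
  2 * ΣC n (suc n)                               ≡⟨ cong (2 *_) (ΣC-row n) ⟩
  2 ^ suc n                                      ∎
  where open ≡-Reasoning

-- Common multiples of 1, …, N

CommonMultiple : ℕ → ℕ → Set
CommonMultiple N D = ∀ {i} → 0 < i → i ≤ N → i ∣ D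

-- The hypothesis says 1 / a + 1 / b = 1 / c, so that D / a = D / c - D / b.
harmonic-∣ : ∀ {a b c D} .{{_ : NonZero b}} → a * b ≡ c * (a + b) → b ∣ D → c ∣ D → a ∣ D
harmonic-∣ {a} {b} {c} {D} eq (divides x D≡xb) (divides y D≡yc) =
  ∣m+n∣m⇒∣n (divides y (*-cancelʳ-≡ _ _ b (begin
    (x * a + D) * b          ≡⟨ expand x a D b ⟩
    x * b * a + D * b        ≡⟨ cong (λ z → z * a + D * b) D≡xb ⟨
    D * a + D * b            ≡⟨ *-distribˡ-+ D a b ⟨
    D * (a + b)              ≡⟨ cong (_* (a + b)) D≡yc ⟩
    y * c * (a + b)          ≡⟨ *-assoc y c _ ⟩
    y * (c * (a + b))        ≡⟨ cong (y *_) eq ⟨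
    y * (a * b)              ≡⟨ *-assoc y a b ⟨
    y * a * b                ∎))) (n∣m*n x)
  where
  open ≡-Reasoning
  expand : ∀ x a D b → (x * a + D) * b ≡ x * b * a + D * b
  expand = solve-∀

-- In Leibniz's triangle, with entries 1 / ((n + 1) C(n, k)), each entry is the sum of the two below
-- it. The extra factor `suc k` lets `absorption` rewrite first `suc k * y` and then `M * x`.
harmonic-triangle : ∀ n k → let a = suc (suc n) * (suc n C suc k); b = suc (suc n) * (suc n C k) in
                    a * b ≡ suc n * (n C k) * (a + b)
harmonic-triangle n k = *-cancelˡ-≡ _ _ (suc k) (begin
  suc k * (M * y * (M * x))                     ≡⟨ lemma₁ (suc k) M y x ⟩
  M * (suc k * y) * (M * x)                     ≡⟨ cong (λ v → M * v * (M * x)) (absorption n k) ⟩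
  M * w * (M * x)                               ≡⟨ cong (M * w *_) (absorption (suc n) k) ⟨
  M * w * (suc k * (suc (suc n) C suc k))       ≡⟨ cong (λ v → M * w * (suc k * v)) (nCk+nC[k+1]≡[n+1]C[k+1] (suc n) k) ⟨
  M * w * (suc k * (x + y))                     ≡⟨ lemma₂ M w (suc k) x y ⟩
  suc k * (w * (M * y + M * x))                 ∎)
  where
  open ≡-Reasoning
  M = suc (suc n)
  w = suc n * (n C k)
  x = suc n C k
  y = suc n C suc k
  lemma₁ : ∀ s M y x → s * (M * y * (M * x)) ≡ M * (s * y) * (M * x)
  lemma₁ = solve-∀
  lemma₂ : ∀ M w s x y → M * w * (s * (x + y)) ≡ s * (w * (M * y + M * x))
  lemma₂ = solve-∀

-- The denominators on the edge `k = 0` are the numbers up to `N`; any other one is reached from its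
-- left neighbour and the entry above both.
[1+n]*nCk∣D : ∀ {N D} → CommonMultiple N D → ∀ {n k} → k ≤ n → n < N → suc n * (n C k) ∣ D
[1+n]*nCk∣D {D = D} cm {n} {zero} _ n<N = subst (_∣ D) (sym (*-identityʳ (suc n))) (cm (s≤s z≤n) n<N)
[1+n]*nCk∣D cm {suc n} {suc k} (s≤s k≤n) n<N =
  harmonic-∣ {{m*n≢0 (suc (suc n)) _ {{_}} {{>-nonZero (k≤n⇒nCk>0 (m≤n⇒m≤1+n k≤n))}}}} (harmonic-triangle n k)
    ([1+n]*nCk∣D cm (m≤n⇒m≤1+n k≤n) n<N)
    ([1+n]*nCk∣D cm k≤n (<⇒≤ n<N))

-- Each of the n + 1 numbers (n + 1) C(n, k) divides `D`, so is at most `D`; together they sum to (n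
-- + 1) 2 ^ n.
2^n≤commonMultiple : ∀ n {D} .{{_ : NonZero D}} → CommonMultiple (suc n) D → 2 ^ n ≤ D
2^n≤commonMultiple n {D} cm =
  *-cancelˡ-≤ (suc n) (subst (λ x → suc n * x ≤ suc n * D) (ΣC-row n) (partial (suc n)))
  where
  open ≤-Reasoning
  term : ∀ k → suc n * (n C k) ≤ D
  term k with k ≤? n
  ... | yes k≤n = ∣⇒≤ ([1+n]*nCk∣D cm k≤n ≤-refl)
  ... | no  k≰n = subst (_≤ D) (sym (trans (cong (suc n *_) (k>n⇒nCk≡0 (≰⇒> k≰n))) (*-zeroʳ (suc n)))) z≤n
  partial : ∀ k → suc n * ΣC n k ≤ k * D
  partial zero    = ≤-reflexive (*-zeroʳ (suc n))
  partial (suc k) = begin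
    suc n * (ΣC n k + n C k)              ≡⟨ *-distribˡ-+ (suc n) (ΣC n k) _ ⟩
    suc n * ΣC n k + suc n * (n C k)      ≤⟨ +-mono-≤ (partial k) (term k) ⟩
    k * D + D                             ≡⟨ +-comm (k * D) D ⟩
    suc k * D                             ∎

-- Prime powers and a weak Chebyshev bound

maximalPower : ∀ p N .{{_ : NonTrivial p}} .{{_ : NonZero N}} → ∃[ e ] p ^ e ≤ N × N < p ^ suc e
maximalPower p 1 = 0 , ≤-refl , subst (1 <_) (sym (*-identityʳ p)) (nonTrivial⇒n>1 p)
maximalPower p (suc N@(suc _)) with maximalPower p N
... | e , p^e≤N , N<p^[1+e] with m≤n⇒m<n∨m≡n N<p^[1+e]
...   | inj₁ 1+N<p^[1+e] = e , m≤n⇒m≤1+n p^e≤N , 1+N<p^[1+e]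
...   | inj₂ 1+N≡p^[1+e] = suc e , ≤-reflexive (sym 1+N≡p^[1+e]) ,
        subst (_< p ^ suc (suc e)) (sym 1+N≡p^[1+e]) (^-monoʳ-< p (nonTrivial⇒n>1 p) (n<1+n (suc e)))

-- The bound on `m` drives the recursion: each division by `p` lowers it by one power, which also
-- gives `a ≤ e`.
splitPower : ∀ p e {m} .{{_ : NonZero p}} .{{_ : NonZero m}} → m < p ^ suc e →
             ∃[ a ] ∃[ m′ ] a ≤ e × m ≡ p ^ a * m′ × p ∤ m′
splitPower p zero    {m} m<p = 0 , m , z≤n , sym (*-identityˡ m) ,
  >⇒∤ (subst (m <_) (*-identityʳ p) m<p)
splitPower p (suc e) {m} {{p≢0}} m<p^ with p ∣? m
... | no  p∤m = 0 , m , z≤n , sym (*-identityˡ m) , p∤m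
... | yes (divides-refl q)
  with splitPower p e {q} {{p≢0}} {{m*n≢0⇒m≢0 q}} (*-cancelʳ-< p q _ (subst (q * p <_) (*-comm p _) m<p^))
... | a , m′ , a≤e , refl , p∤m′ =
  suc a , m′ , s≤s a≤e , trans (*-comm (p ^ a * m′) p) (sym (*-assoc p (p ^ a) m′)) , p∤m′

^-monoʳ-∣ : ∀ p {a e} → a ≤ e → p ^ a ∣ p ^ e
^-monoʳ-∣ p z≤n       = 1∣ _
^-monoʳ-∣ p (s≤s a≤e) = *-monoʳ-∣ p (^-monoʳ-∣ p a≤e)

noPrimeDivisor⇒≡1 : ∀ m .{{_ : NonZero m}} → (∀ {q} → Prime q → ¬ q ∣ m) → m ≡ 1
noPrimeDivisor⇒≡1 m none with factorise m
... | record { factors = []     ; isFactorisation = eq } = eq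
... | record { factors = q ∷ qs ; isFactorisation = eq ; factorsPrime = pr ∷ _ } =
  contradiction (subst (q ∣_) (sym eq) (m∣m*n (product qs))) (none pr)

-- `D` is the product, over `ps`, of the largest power of each prime not exceeding `N`. Splitting
-- the power of `p` off `m` leaves a cofactor whose prime divisors lie in the rest of the list.
smoothCommonMultiple : ∀ N .{{_ : NonZero N}} {ps} → All Prime ps →
  ∃[ D ] NonZero D × D ≤ N ^ length ps ×
    (∀ {m} → 0 < m → m ≤ N → (∀ {q} → Prime q → q ∣ m → q ∈ ps) → m ∣ D)
smoothCommonMultiple N [] = 1 , _ , ≤-refl , λ {m} 0<m _ none →
  ∣-reflexive (noPrimeDivisor⇒≡1 m {{>-nonZero 0<m}} (λ pr q∣m → contradiction (none pr q∣m) λ ()))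
smoothCommonMultiple N {p ∷ ps} (pr ∷ prs)
  with maximalPower p N {{prime⇒nonTrivial pr}} | smoothCommonMultiple N prs
... | e , p^e≤N , N<p^[1+e] | D , nz , D≤ , mult =
  p ^ e * D , m*n≢0 (p ^ e) D {{m^n≢0 p e {{p≢0}}}} {{nz}} , *-mono-≤ p^e≤N D≤ , mult′
  where
  instance p≢0 = prime⇒nonZero pr
  mult′ : ∀ {m} → 0 < m → m ≤ N → (∀ {q} → Prime q → q ∣ m → q ∈ p ∷ ps) → m ∣ p ^ e * D
  mult′ {m} 0<m m≤N primes
    with splitPower p e {{p≢0}} {{>-nonZero 0<m}} (≤-<-trans m≤N N<p^[1+e])
  ... | a , m′ , a≤e , refl , p∤m′ = *-pres-∣ (^-monoʳ-∣ p a≤e) (mult 0<m′ m′≤N primes′)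
    where
    instance m≢0 = >-nonZero 0<m
    m′∣m = n∣m*n (p ^ a) {m′}
    m′≤N = ≤-trans (∣⇒≤ m′∣m) m≤N
    0<m′ = >-nonZero⁻¹ m′ {{m*n≢0⇒n≢0 (p ^ a)}}
    primes′ : ∀ {q} → Prime q → q ∣ m′ → q ∈ ps
    primes′ qr q∣m′ with primes qr (∣-trans q∣m′ m′∣m)
    ... | here refl  = contradiction q∣m′ p∤m′
    ... | there q∈ps = q∈ps

-- The list of primes up to n + 1 contains every prime divisor of 1, ..., n + 1, and its length is
-- the exponent `π (suc n)` by definition.
chebyshev : ∀ n → 2 ^ n ≤ suc n ^ π (suc n)
chebyshev n with smoothCommonMultiple (suc n) (all-filter prime? (applyUpTo suc (suc n)))
... | D , nz , D≤ , mult = ≤-trans (2^n≤commonMultiple n {{nz}} commonMultiple) D≤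
  where
  commonMultiple : CommonMultiple (suc n) D
  commonMultiple {i} 0<i i≤N = mult 0<i i≤N listed
    where
    listed : ∀ {q} → Prime q → q ∣ i → q ∈ filter prime? (applyUpTo suc (suc n))
    listed {zero}  pr _   = contradiction pr λ ()
    listed {suc q} pr q∣i =
      ∈-filter⁺ prime? (∈-applyUpTo⁺ suc (≤-trans (∣⇒≤ {{>-nonZero 0<i}} q∣i) i≤N)) pr

-- Repeated differences

-- Pigeonhole on the `k * pred k` ordered pairs of distinct elements: shifted by `N`, their
-- differences are naturals below 2 N.
repeatedDifference : ∀ {ℓ} {S : Pred ℕ ℓ} {k N} → k ≤∣ S ∩ [1, N ] ∣ → N + N < k * pred k →
  ∃[ a ] ∃[ b ] ∃[ c ] ∃[ d ] (S a × S b × S c × S d) × a + d ≡ c + b × a ≢ b × a ≢ c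
repeatedDifference {k = suc j} {N} (f , f-inj , f∈) 2N<kj
  with Fin.pigeonhole 2N<kj (λ i → fromℕ< (diff<2N (remQuot j i)))
  where
  -- `punchIn i` skips `i`, so the two indices always differ.
  diff : Fin (suc j) × Fin j → ℕ
  diff (i , l) = f i + (N ∸ f (punchIn i l))
  diff<2N : ∀ p → diff p < N + N
  diff<2N (i , l) with f (punchIn i l) | f∈ (punchIn i l)
  -- The subtracted element is at least 1, which makes the bound 2 N strict.
  ... | suc v | _ , _ , s≤s _ = +-mono-≤-< (proj₂ (proj₂ (f∈ i))) (s≤s (m∸n≤m _ v))
... | s , t , s<t , eq =
  f i , f i′ , f l , f l′ , (proj₁ (f∈ i) , proj₁ (f∈ i′) , proj₁ (f∈ l) , proj₁ (f∈ l′)) ,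
  +-cancelʳ-≡ N _ _ sums , (λ e → Fin.punchInᵢ≢i i v (sym (f-inj e))) , distinct
  where
  i  = proj₁ (remQuot {suc j} j s)
  v  = proj₂ (remQuot {suc j} j s)
  i′ = punchIn i v
  l  = proj₁ (remQuot {suc j} j t)
  w  = proj₂ (remQuot {suc j} j t)
  l′ = punchIn l w

  diffs : f i + (N ∸ f i′) ≡ f l + (N ∸ f l′)
  diffs = Fin.fromℕ<-injective _ _ _ _ eq

  open ≡-Reasoning
  -- Adding both subtracted elements undoes the truncated subtractions, leaving `N` on each side to
  -- cancel.
  restore : ∀ x y {z} → z ≤ N → x + (N ∸ z) + (z + y) ≡ x + y + N
  restore x y {z} z≤N = begin
    x + (N ∸ z) + (z + y)   ≡⟨ lemma x (N ∸ z) z y ⟩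
    x + y + (N ∸ z + z)     ≡⟨ cong (_+_ (x + y)) (m∸n+n≡m z≤N) ⟩
    x + y + N               ∎
    where
    lemma : ∀ x u z y → x + u + (z + y) ≡ x + y + (u + z)
    lemma = solve-∀
  sums : f i + f l′ + N ≡ f l + f i′ + N
  sums = begin
    f i + f l′ + N                       ≡⟨ restore (f i) (f l′) (proj₂ (proj₂ (f∈ i′))) ⟨
    f i + (N ∸ f i′) + (f i′ + f l′)     ≡⟨ cong₂ _+_ diffs (+-comm (f i′) (f l′)) ⟩
    f l + (N ∸ f l′) + (f l′ + f i′)     ≡⟨ restore (f l) (f i′) (proj₂ (proj₂ (f∈ l′))) ⟩
    f l + f i′ + N                       ∎

  -- Equal first elements would force equal second ones, so both pairs, and hence `s` and `t`, would
  -- coincide.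
  distinct : f i ≢ f l
  distinct fi≡fl = Fin.<⇒≢ s<t (begin
    s                                    ≡⟨ Fin.combine-remQuot {suc j} j s ⟨
    combine i v                          ≡⟨ uncurry (cong₂ combine) (samePair i≡l i′≡l′) ⟩
    combine l w                          ≡⟨ Fin.combine-remQuot {suc j} j t ⟩
    t                                    ∎)
    where
    i≡l = f-inj fi≡fl
    i′≡l′ : i′ ≡ l′
    i′≡l′ = f-inj (sym (+-cancelˡ-≡ (f i) _ _ (trans (+-cancelʳ-≡ N _ _ sums) (cong (_+ f i′) (sym fi≡fl)))))
    samePair : ∀ {x y : Fin (suc j)} {p q} → x ≡ y → punchIn x p ≡ punchIn y q → x ≡ y × p ≡ q
    samePair {x} refl e = refl , Fin.punchIn-injective x _ _ e

-- Exponential versus polynomial growth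

-- The start 10 comes from 1000 ≤ 1024; already 9³ exceeds 2 ^ 9.
cube≤2^ : ∀ n → (10 + n) * ((10 + n) * (10 + n)) ≤ 2 ^ (10 + n)
cube≤2^ zero    = ≤ᵇ⇒≤ 1000 1024 _
cube≤2^ (suc n) = begin
  (11 + n) * ((11 + n) * (11 + n))                                        ≤⟨ m≤m+n _ _ ⟩
  -- The added polynomial is 2 (10 + n)³ - (11 + n)³, whose coefficients are all positive.
  (11 + n) * ((11 + n) * (11 + n)) + (n * (n * n) + 27 * (n * n) + 237 * n + 669) ≡⟨ expand n ⟩
  2 * ((10 + n) * ((10 + n) * (10 + n)))                                  ≤⟨ *-monoʳ-≤ 2 (cube≤2^ n) ⟩
  2 * 2 ^ (10 + n)                                                        ∎
  where
  open ≤-Reasoning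
  expand : ∀ n → (11 + n) * ((11 + n) * (11 + n)) + (n * (n * n) + 27 * (n * n) + 237 * n + 669)
             ≡ 2 * ((10 + n) * ((10 + n) * (10 + n)))
  expand = solve-∀

2^-cancel-< : ∀ {m n} → 2 ^ m < 2 ^ n → m < n
2^-cancel-< {m} {n} lt with m <? n
... | yes m<n = m<n
... | no  m≮n = contradiction (^-monoʳ-≤ 2 (≮⇒≥ m≮n)) (<⇒≱ lt)

2^-cancel-≤ : ∀ {m n} → 2 ^ m ≤ 2 ^ n → m ≤ n
2^-cancel-≤ {m} {n} le with m ≤? n
... | yes m≤n = m≤n
... | no  m≰n = contradiction (^-monoʳ-< 2 (s≤s (s≤s z≤n)) (≰⇒> m≰n)) (≤⇒≯ le)

-- Over the integers, the right side exceeds the left by (k - 1)².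
k*k≤2*k[k-1]+1 : ∀ k → k * k ≤ suc (2 * (k * pred k))
k*k≤2*k[k-1]+1 zero          = z≤n
k*k≤2*k[k-1]+1 (suc zero)    = ≤-refl
k*k≤2*k[k-1]+1 (suc (suc n)) = begin
  (2 + n) * (2 + n)                                  ≤⟨ m≤m+n _ _ ⟩
  (2 + n) * (2 + n) + (n * n + 2 * n + 1)            ≡⟨ expand n ⟩
  suc (2 * ((2 + n) * (1 + n)))                      ∎
  where
  open ≤-Reasoning
  expand : ∀ n → (2 + n) * (2 + n) + (n * n + 2 * n + 1) ≡ suc (2 * ((2 + n) * (1 + n)))
  expand = solve-∀

-- If N < 2 ^ s with s minimal and k (k ∸ 1) ≤ 2 N, then 2 ^ (N - 1) ≤ N ^ (k b)
-- gives N ≤ 2 s k b, so that N ≤ 20 s² b² and s³ ≤ 2 ^ s ≤ 2 N ≤ 40 b² s².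
threshold : ℕ → ℕ
threshold b = 2 ^ (40 * (b * b) + 10)

manyElements : ∀ b .{{_ : NonZero b}} n k → threshold b ≤ suc n → 2 ^ n ≤ suc n ^ (k * b) →
               suc n + suc n < k * pred k
manyElements b n k large bound with suc n + suc n <? k * pred k
... | yes many = many
... | no  few  with maximalPower 2 (suc n)
... | e , 2^e≤N , N<2^s = contradiction s≤40b² (<⇒≱ (≤-trans (s≤s (m≤m+n (40 * (b * b)) 10)) large′))
  where
  open ≤-Reasoning
  N = suc n
  s = suc e
  -- The summand 40 b² will contradict `s≤40b²`; the summand 10 puts `s` in the range of `cube≤2^`.
  large′ : 40 * (b * b) + 10 < s
  large′ = 2^-cancel-< (≤-<-trans large N<2^s)

  n≤s*kb : n ≤ s * (k * b)
  n≤s*kb = 2^-cancel-≤ (begin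
    2 ^ n               ≤⟨ bound ⟩
    N ^ (k * b)         ≤⟨ ^-monoˡ-≤ (k * b) (<⇒≤ N<2^s) ⟩
    (2 ^ s) ^ (k * b)   ≡⟨ ^-*-assoc 2 s (k * b) ⟩
    2 ^ (s * (k * b))   ∎)

  1≤n : 1 ≤ n
  1≤n = s≤s⁻¹ (≤-trans (^-monoʳ-≤ 2 {1} {40 * (b * b) + 10} (≤-trans (s≤s z≤n) (m≤n+m 10 (40 * (b * b))))) large)

  N≤2skb : N ≤ 2 * (s * (k * b))
  N≤2skb = begin
    1 + n                 ≤⟨ +-monoˡ-≤ n 1≤n ⟩
    n + n                 ≡⟨ cong (_+_ n) (+-identityʳ n) ⟨
    2 * n                 ≤⟨ *-monoʳ-≤ 2 n≤s*kb ⟩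
    2 * (s * (k * b))     ∎

  k²≤4N : k * k ≤ 4 * N + 1
  k²≤4N = begin
    k * k                       ≤⟨ k*k≤2*k[k-1]+1 k ⟩
    suc (2 * (k * pred k))      ≤⟨ s≤s (*-monoʳ-≤ 2 (≮⇒≥ few)) ⟩
    suc (2 * (N + N))           ≡⟨ lemma N ⟩
    4 * N + 1                   ∎
    where
    lemma : ∀ N → suc (2 * (N + N)) ≡ 4 * N + 1
    lemma = solve-∀

  -- Squaring `N≤2skb` brings in k², which is at most 5 N by `k²≤4N`; then one factor `N` cancels.
  N≤ : N ≤ 20 * ((s * s) * (b * b))
  N≤ = *-cancelʳ-≤ N _ N (begin
    N * N                                          ≤⟨ *-mono-≤ N≤2skb N≤2skb ⟩
    2 * (s * (k * b)) * (2 * (s * (k * b)))        ≡⟨ lemma₁ s k b ⟩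
    4 * ((s * s) * (b * b)) * (k * k)              ≤⟨ *-monoʳ-≤ (4 * ((s * s) * (b * b))) k²≤4N ⟩
    4 * ((s * s) * (b * b)) * (4 * N + 1)          ≤⟨ *-monoʳ-≤ (4 * ((s * s) * (b * b))) (+-monoʳ-≤ (4 * N) (s≤s (z≤n {n}))) ⟩
    4 * ((s * s) * (b * b)) * (4 * N + N)          ≡⟨ lemma₂ ((s * s) * (b * b)) N ⟩
    20 * ((s * s) * (b * b)) * N                   ∎)
    where
    lemma₁ : ∀ s k b → 2 * (s * (k * b)) * (2 * (s * (k * b))) ≡ 4 * ((s * s) * (b * b)) * (k * k)
    lemma₁ = solve-∀
    lemma₂ : ∀ x N → 4 * x * (4 * N + N) ≡ 20 * x * N
    lemma₂ = solve-∀

  s³≤2^s : s * (s * s) ≤ 2 ^ s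
  s³≤2^s = subst (λ x → x * (x * x) ≤ 2 ^ x) (m+[n∸m]≡n (≤-trans (m≤n+m 10 _) (<⇒≤ large′))) (cube≤2^ (s ∸ 10))

  s≤40b² : s ≤ 40 * (b * b)
  s≤40b² = *-cancelʳ-≤ s _ (s * s) (begin
    s * (s * s)                          ≤⟨ s³≤2^s ⟩
    2 * 2 ^ e                            ≤⟨ *-monoʳ-≤ 2 2^e≤N ⟩
    2 * N                                ≤⟨ *-monoʳ-≤ 2 N≤ ⟩
    2 * (20 * ((s * s) * (b * b)))       ≡⟨ lemma (s * s) (b * b) ⟩
    40 * (b * b) * (s * s)               ∎)
    where
    lemma : ∀ x y → 2 * (20 * (x * y)) ≡ 40 * y * x
    lemma = solve-∀

-- Density

-- Take for `b` the denominator of `r`. The numerator is at least 1, so cross-multiplying r < k / p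
-- gives p < k b.
density⇒count : ∀ {r} → 0ℚ ℚ.< r → ∃[ b ] NonZero b ×
  (∀ p k (p≢0 : NonZero p) → r ℚ.< ℚ._/_ (ℤ.+ k) p {{p≢0}} → p ≤ k * b)
density⇒count {ℚ.mkℚ (ℤ.+ zero)  _ _} (ℚ.*<* (ℤ.+<+ ()))
density⇒count {ℚ.mkℚ ℤ.-[1+ _ ]  _ _} (ℚ.*<* ())
density⇒count {r@(ℚ.mkℚ (ℤ.+ suc a) b-1 _)} _ = suc b-1 , _ , bound
  where
  bound : ∀ p k (p≢0 : NonZero p) → r ℚ.< ℚ._/_ (ℤ.+ k) p {{p≢0}} → p ≤ k * suc b-1
  -- The rational k / p is stored in lowest terms, so the cross-multiplication takes place in the
  -- unnormalised rationals.
  bound p@(suc p-1) k _ r<k/p = ≤-trans (m≤m+n p (a * p)) (<⇒≤ (ℤ.drop‿+<+ (subst₂ ℤ._<_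
    (sym (ℤ.pos-* (suc a) p)) (sym (ℤ.pos-* k (suc b-1)))
    (ℚᵘ.drop-*<* (ℚᵘ.<-respʳ-≃ (ℚ.toℚᵘ-fromℚᵘ (ℚᵘ.mkℚᵘ (ℤ.+ k) p-1)) (ℚ.toℚᵘ-mono-< r<k/p))))))

-- Signed sums

⟦_⟧_ : Bool → ℕ → ℕ
⟦ x ⟧ n = if x then n else 0

+if : ∀ x n → (if x then Sign.+ ◃ n else 0ℤ) ≡ ℤ.+ (⟦ x ⟧ n)
+if true  n = ℤ.+◃n≡+n n
+if false n = refl

-if : ∀ x n → (if x then Sign.- ◃ n else 0ℤ) ≡ ℤ.- (ℤ.+ (⟦ x ⟧ n))
-if true  n = ℤ.-◃n≡-n n
-if false n = refl

cycleSigns : Fin 4 → Sign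
cycleSigns = Vec.lookup (Sign.+ ∷ Sign.+ ∷ Sign.- ∷ Sign.- ∷ [])

cycleTerms : (a b c d : ℕ) → Fin 4 → ℕ
cycleTerms a b c d = Vec.lookup (a ∷ d ∷ b ∷ c ∷ [])

-- Separating the positive terms from the negative ones turns the vanishing of a subsum into an
-- equation in ℕ.
subsum-cycle : ∀ a b c d x y z w →
  subsum (x ∷ y ∷ z ∷ w ∷ []) (λ i → cycleSigns i ◃ cycleTerms a b c d i)
    ≡ ℤ.+ (⟦ x ⟧ a + ⟦ y ⟧ d) ℤ.- ℤ.+ (⟦ z ⟧ b + ⟦ w ⟧ c)
subsum-cycle a b c d x y z w = begin
  (if x then Sign.+ ◃ a else 0ℤ) ℤ.+ ((if y then Sign.+ ◃ d else 0ℤ) ℤ.+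
    ((if z then Sign.- ◃ b else 0ℤ) ℤ.+ ((if w then Sign.- ◃ c else 0ℤ) ℤ.+ 0ℤ)))
    ≡⟨ cong₂ ℤ._+_ (+if x a) (cong₂ ℤ._+_ (+if y d) (cong₂ ℤ._+_ (-if z b)
         (trans (ℤ.+-identityʳ _) (-if w c)))) ⟩
  p ℤ.+ (q ℤ.+ (ℤ.- r ℤ.+ ℤ.- s))    ≡⟨ ℤ.+-assoc p q (ℤ.- r ℤ.+ ℤ.- s) ⟨
  p ℤ.+ q ℤ.+ (ℤ.- r ℤ.+ ℤ.- s)      ≡⟨ cong (ℤ._+_ (p ℤ.+ q)) (ℤ.neg-distrib-+ r s) ⟨
  p ℤ.+ q ℤ.- (r ℤ.+ s)              ∎
  where
  open ≡-Reasoning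
  p = ℤ.+ (⟦ x ⟧ a)
  q = ℤ.+ (⟦ y ⟧ d)
  r = ℤ.+ (⟦ z ⟧ b)
  s = ℤ.+ (⟦ w ⟧ c)

-- Terms of one sign cannot cancel. One term of each sign would give a = b or a = c, if necessary by
-- way of the total. Three terms would leave the fourth equal to 0.
vanishing⇒trivial : ∀ {a b c d} → 0 < a → 0 < b → 0 < c → 0 < d → a + d ≡ c + b → a ≢ b → a ≢ c →
  ∀ x y z w → ⟦ x ⟧ a + ⟦ y ⟧ d ≡ ⟦ z ⟧ b + ⟦ w ⟧ c →
  x ∷ y ∷ z ∷ w ∷ [] ≡ Vec.replicate 4 true ⊎ x ∷ y ∷ z ∷ w ∷ [] ≡ Vec.replicate 4 false
vanishing⇒trivial {a@(suc _)} {b@(suc _)} {c@(suc _)} {d@(suc _)} _ _ _ _ sum a≢b a≢c = go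
  where
  open ≡-Reasoning
  go : ∀ x y z w → ⟦ x ⟧ a + ⟦ y ⟧ d ≡ ⟦ z ⟧ b + ⟦ w ⟧ c →
       x ∷ y ∷ z ∷ w ∷ [] ≡ Vec.replicate 4 true ⊎ x ∷ y ∷ z ∷ w ∷ [] ≡ Vec.replicate 4 false
  go false false false false _  = inj₂ refl
  go false false false true  ()
  go false false true  false ()
  go false false true  true  ()
  go false true  false false ()
  go false true  false true  e  = contradiction (+-cancelʳ-≡ d a b (trans sum (trans (cong (_+ b) (sym e)) (+-comm d b)))) a≢b
  go false true  true  false e  = contradiction (+-cancelʳ-≡ d a c (trans sum (cong (_+_ c) (trans (sym (+-identityʳ b)) (sym e))))) a≢c
  go false true  true  true  e  = contradiction (sym (trans sum (trans (+-comm c b) (sym e)))) (m≢1+n+m d)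
  go true  false false false ()
  go true  false false true  e  = contradiction (trans (sym (+-identityʳ a)) e) a≢c
  go true  false true  false e  = contradiction (+-cancelʳ-≡ 0 a b e) a≢b
  go true  false true  true  e  = contradiction (trans sum (trans (+-comm c b) (trans (sym e) (+-identityʳ a)))) (m+1+n≢m a)
  go true  true  false false ()
  go true  true  false true  e  = contradiction (trans (sym sum) e) (m+1+n≢m c)
  go true  true  true  false e  = contradiction (sym (trans (sym sum) (trans e (+-identityʳ b)))) (m≢1+n+m b)
  go true  true  true  true  _  = inj₁ refl

cycle : ∀ {ℓ} {A : Pred ℕ ℓ} → A ⊆ Prime → ∀ {a b c d} → A a × A b × A c × A d →
        a + d ≡ c + b → a ≢ b → a ≢ c → LinearlyAdmits4Cycle A
cycle {A = A} A⊆P {a} {b} {c} {d} (a∈ , b∈ , c∈ , d∈) sum a≢b a≢c =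
  cycleSigns , cycleTerms a b c d , terms , total , proper
  where
  positive : ∀ {p} → A p → 0 < p
  positive {p} p∈ = >-nonZero⁻¹ p {{prime⇒nonZero (A⊆P p∈)}}

  term : ∀ {p} → A p → 0 < p × ProductOfDistinct A p
  term {p} p∈ = positive p∈ , p ∷ [] , [] ∷ [] , p∈ ∷ [] , *-identityʳ p

  terms : ∀ i → 0 < cycleTerms a b c d i × ProductOfDistinct A (cycleTerms a b c d i)
  terms zero                   = term a∈
  terms (suc zero)             = term d∈
  terms (suc (suc zero))       = term b∈
  terms (suc (suc (suc zero))) = term c∈

  -- The full sum is the subsum over `⊤` by computation, so `subsum-cycle` covers it too.
  total : subsum ⊤ (λ i → cycleSigns i ◃ cycleTerms a b c d i) ≡ 0ℤ
  total = trans (subsum-cycle a b c d true true true true)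
    (ℤ.i≡j⇒i-j≡0 (cong ℤ.+_ (trans sum (+-comm c b))))

  proper : ∀ I → Nonempty I → I ⊂ ⊤ → subsum I (λ i → cycleSigns i ◃ cycleTerms a b c d i) ≢ 0ℤ
  proper (x ∷ y ∷ z ∷ w ∷ []) (_ , i∈I) (_ , _ , j∈⊤ , j∉I) e
    with vanishing⇒trivial (positive a∈) (positive b∈) (positive c∈) (positive d∈) sum a≢b a≢c x y z w
           (ℤ.+-injective (ℤ.i-j≡0⇒i≡j _ _ (trans (sym (subsum-cycle a b c d x y z w)) e)))
  ... | inj₁ refl = j∉I j∈⊤
  ... | inj₂ refl = ∉⊥ i∈I

-- From positive density to a 4-cycle

corollary2p7 : ∀ {ℓ : Level} (A : Pred ℕ ℓ) → A ⊆ Prime → PositiveUpperDensity A → LinearlyAdmits4Cycle A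
corollary2p7 A A⊆P (r , 0<r , frequently) with density⇒count 0<r
-- The rational `r` from `inf` lies below the relative count for arbitrarily large N, so such an N
-- can be chosen at or above the threshold.
... | b , b≢0 , count with frequently (threshold b)
... | zero  , large , _ = contradiction large (<⇒≱ (m^n>0 2 (40 * (b * b) + 10)))
... | suc n , large , k , k≤∣A∣ , π≢0 , r<k/π
  -- By `count`, π(N) ≤ k b, which replaces the exponent in `chebyshev`.
  with repeatedDifference k≤∣A∣ (manyElements b {{b≢0}} n k large
         (≤-trans (chebyshev n) (^-monoʳ-≤ (suc n) (count (π (suc n)) k π≢0 r<k/π))))
... | _ , _ , _ , _ , members , sum , a≢b , a≢c = cycle A⊆P members sum a≢b a≢c
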